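{- Let $\gamma$ be a weak composition of length $n$ and let $\alpha=\gamma^+$. The set of column-strict composition tableaux of shape $\alpha$ with first column $\mathcal{F}(\gamma)$ is in bijection with the set of composition array patterns of shape $\gamma$.
   Context: A weak composition of length $n$ is a sequence $\gamma=(\gamma_1,\dots,\gamma_n)$ of nonnegative integers; $\gamma^+$ is the sequence obtained by deleting its zero parts; $\mathcal{F}(\gamma)=\{i\mid\gamma_i>0\}$. The diagram of $\alpha$ has left-justified rows with $\alpha_i$ boxes in row $i$ from the top. A column-strict composition tableau (CT) of shape $\alpha$ (with $k$ parts, all positive, and largest part $m$) is a filling $U$ of the diagram of $\alpha$ with positive integers such that (1) the first column is strictly increasing from top to bottom; (2) each row is weakly decreasing from left to right; (3) (Triple Rule) if $\hat U$ is the $k\times m$ array obtained by adding zeros at the ends of the rows of $U$, then for $1\le i_1<i_2\le k$ and $2\le j\le m$: if $\hat U(i_2,j)\neq0$ and $\hat U(i_2,j)\ge\hat U(i_1,j)$ then $\hat U(i_2,j)>\hat U(i_1,j-1)$. "First column $\mathcal{F}(\gamma)$" means that the set of entries in the first column is $\mathcal{F}(\gamma)$. A composition array pattern of shape $\gamma$ is a triangular array $X_n^\gamma=(x_{i,j})$, $1\le i\le n$, $1\le j\le n-i+1$, of nonnegative integers such that (1) $\gamma_i=x_{1,i}$ for $1\le i\le n$; (2) $x_{i,j}\le x_{i-1,j+1}$ for $2\le i\le n$, $1\le j\le n-i+1$; (3) for all $1\le i\le n-1$ and all $0\le r<s\le n-i$, with the convention $x_{l,0}=0$ for all $l$: (a)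 if $x_{i+1,r}\ge x_{i+1,s}$ then $x_{i+1,r}\ge x_{i,s+1}$; and (b) if $x_{i+1,r}<x_{i+1,s}<x_{i,s+1}$ then $x_{i,r+1}<x_{i+1,s}$. -}

module Defs where

open import Data.Fin as Fin using (Fin; toℕ; fromℕ<)
open import Data.List using (List; length; lookup; filter)
open import Data.List.Extrema.Nat using (max)
open import Data.List.Membership.Propositional.Properties using (∈-lookup)
open import Data.List.Relation.Unary.All as All using (All)
open import Data.List.Relation.Unary.All.Properties using (all-filter)
open import Data.Nat using (ℕ; zero; suc; _+_; _∸_; _≤_; _<_; _≥_; _>_; _<?_)
open import Data.Product using (Σ; ∃-syntax; _×_; _,_)
open import Data.Vec as Vec using (Vec)
open import Level using (0ℓ)
open import Relation.Binary.Bundles using (Setoid)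
open import Relation.Binary.PropositionalEquality using (_≡_; _≢_; _→-setoid_)
import Relation.Binary.Construct.On as On
open import Relation.Nullary using (yes; no)
open import Relation.Unary using (Pred; _≐_)

record Composition : Set where
  field
    parts    : List ℕ
    positive : All (0 <_) parts

  rows : ℕ
  rows = length parts

  part : Fin rows → ℕ
  part = lookup parts

  part-positive : ∀ i → 0 < part i
  part-positive i = All.lookup positive (∈-lookup i)

  largest : ℕ
  largest = max 0 parts

WeakComposition : ℕ → Set
WeakComposition n = Vec ℕ n

infix 9 _⁺

_⁺ : ∀ {n} → WeakComposition n → Composition
γ ⁺ = record
  { parts    = filter (0 <?_) (Vec.toList γ)
  ; positive = all-filter (0 <?_) (Vec.toList γ)
  }

-- Positions are numbered from 1 here, whereas Fin counts from 0.
𝓕 : ∀ {n} → WeakComposition n → Pred ℕ 0ℓ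
𝓕 γ v = ∃[ i ] v ≡ suc (toℕ i) × 0 < Vec.lookup γ i

-- Rows and columns of diagrams are numbered from 0.
Cell : Composition → Set
Cell α = Σ (Fin rows) λ i → Fin (part i)
  where open Composition α

module _ (α : Composition) where
  open Composition α

  first : Fin rows → Cell α
  first i = i , fromℕ< (part-positive i)

  firstColumn : (Cell α → ℕ) → Pred ℕ 0ℓ
  firstColumn U v = ∃[ i ] U (first i) ≡ v

  -- The filling with zeros added at the ends of its rows.
  padded : (Cell α → ℕ) → Fin rows → ℕ → ℕ
  padded U i j with j <? part i
  ... | yes j<αᵢ = U (i , fromℕ< j<αᵢ)
  ... | no  _    = 0

  -- Columns are 0-based here as well: suc j ranges over all but the first of
  -- the columns of the padded array.
  TripleRule : (Cell α → ℕ) → Set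
  TripleRule U = ∀ {i₁ i₂} j → i₁ Fin.< i₂ → suc j < largest →
                 Û i₂ (suc j) ≢ 0 → Û i₂ (suc j) ≥ Û i₁ (suc j) →
                 Û i₂ (suc j) > Û i₁ j
    where
    Û : Fin rows → ℕ → ℕ
    Û = padded U

  record IsColumnStrict (U : Cell α → ℕ) : Set where
    field
      positive-entries : ∀ c → 0 < U c
      first-increasing : ∀ {i₁ i₂} → i₁ Fin.< i₂ → U (first i₁) < U (first i₂)
      rows-decreasing  : ∀ i {j₁ j₂} → j₁ Fin.≤ j₂ → U (i , j₂) ≤ U (i , j₁)
      triple-rule      : TripleRule U

record CT (α : Composition) (S : Pred ℕ 0ℓ) : Set where
  field
    entry          : Cell α → ℕ
    isColumnStrict : IsColumnStrict α entry
    firstColumn≐   : firstColumn α entry ≐ S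

-- Tableaux are equal when their entries are; the proofs carried along
-- are disregarded.
CT-setoid : Composition → Pred ℕ 0ℓ → Setoid 0ℓ 0ℓ
CT-setoid α S = On.setoid {B = CT α S} (Cell α →-setoid ℕ) CT.entry

-- The pair (i , j) stands for the 1-based position (i + 1 , j + 1), so the
-- 1-based row i has n - i + 1 positions.
Position : ℕ → Set
Position n = Σ (Fin n) λ i → Fin (n ∸ toℕ i)

-- Entry at a 1-based position; zero in column 0, as the convention x_{l,0} = 0
-- requires, and (immaterially) at every other position outside the triangle.
infix 10 _[_,_]

_[_,_] : ∀ {n} → (Position n → ℕ) → ℕ → ℕ → ℕ
X [ zero  , _    ] = 0
X [ suc _ , zero ] = 0
_[_,_] {n} X (suc i) (suc j) with i <? n
... | no  _   = 0
... | yes i<n with j <? n ∸ toℕ (fromℕ< i<n)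
...   | no  _ = 0
...   | yes j<n-i = X (fromℕ< i<n , fromℕ< j<n-i)

record IsPattern {n} (γ : WeakComposition n) (X : Position n → ℕ) : Set where
  field
    shape      : ∀ i → Vec.lookup γ i ≡ X [ 1 , suc (toℕ i) ]
    decreasing : ∀ i j → 2 ≤ i → i ≤ n → 1 ≤ j → j ≤ n ∸ i + 1 →
                 X [ i , j ] ≤ X [ i ∸ 1 , j + 1 ]
    condition-a : ∀ i r s → 1 ≤ i → i ≤ n ∸ 1 → r < s → s ≤ n ∸ i →
                  X [ i + 1 , r ] ≥ X [ i + 1 , s ] →
                  X [ i + 1 , r ] ≥ X [ i , s + 1 ]
    condition-b : ∀ i r s → 1 ≤ i → i ≤ n ∸ 1 → r < s → s ≤ n ∸ i →
                  X [ i + 1 , r ] < X [ i + 1 , s ] →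
                  X [ i + 1 , s ] < X [ i , s + 1 ] →
                  X [ i , r + 1 ] < X [ i + 1 , s ]

record CAP {n} (γ : WeakComposition n) : Set where
  field
    entry     : Position n → ℕ
    isPattern : IsPattern γ entry

CAP-setoid : ∀ {n} → WeakComposition n → Setoid 0ℓ 0ℓ
CAP-setoid {n} γ = On.setoid {B = CAP γ} (Position n →-setoid ℕ) CAP.entry

{-# OPTIONS --safe #-}
-- Read the entries of a tableau row by row, indexing the rows by their first
-- entries: f i j is the entry in column j of the row with first entry i, with
-- zeros added and with an all-zero row whenever γᵢ = 0.  The pattern records the
-- conjugate sequences: x_{t,j} is the number of entries ≥ t in the row with
-- first entry t + j − 1, so that passing from row t of the pattern to row t + 1
-- follows a diagonal.  Conjugation is encoded, with j and t both counted from 0,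
-- by the symmetric relation t < f j ⇔ j < g t, which determines f from g and g
-- from f; under it the Triple Rule for two rows, at the cells of the lower row
-- with entry t, becomes conditions (a) and (b), at i = t, for the two diagonals.
module Submission where

open import Defs
open import Data.Fin as Fin using (Fin; zero; suc; toℕ; fromℕ<)
import Data.Fin.Properties as Fin
open import Data.List.Extrema.Nat using (xs≤max)
open import Data.List.Membership.Propositional.Properties using (∈-lookup)
open import Data.List.Relation.Unary.All as All using ()
open import Data.Nat
open import Data.Nat.Properties
open import Data.Product using (∃-syntax; Σ-syntax; _,_; proj₁; proj₂; map₂)
open import Data.Sum as Sum using (_⊎_; inj₁; inj₂; [_,_]′)
open import Data.Vec as Vec using (_∷_)
open import Function using (_∘_; _⇔_; mk⇔; Equivalence)
open import Function.Bundles using (Bijection)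
open import Function.Construct.Symmetry using (⇔-sym)
open import Relation.Binary.PropositionalEquality hiding ([_])
open import Relation.Nullary using (yes; no; contradiction)

open Equivalence using (to; from)

-- Conjugate sequences

Conjugate : (f g : ℕ → ℕ) → Set
Conjugate f g = ∀ j t → t < f j ⇔ j < g t

conjugate-sym : ∀ {f g} → Conjugate f g → Conjugate g f
conjugate-sym c t j = ⇔-sym (c j t)

module _ {f g : ℕ → ℕ} (c : Conjugate f g) where

  conjugate-≤ : ∀ {j t} → f j ≤ t → g t ≤ j
  conjugate-≤ fj≤t = ≮⇒≥ (≤⇒≯ fj≤t ∘ from (c _ _))

  -- The set of t with `j < g t` shrinks as j grows, so having any conjugate at all forces a
  -- sequence to be antitone.
  conjugate-antitone : ∀ {j k} → j ≤ k → f k ≤ f j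
  conjugate-antitone j≤k =
    ≮⇒≥ λ fj<fk → <-irrefl refl (from (c _ _) (≤-<-trans j≤k (to (c _ _) fj<fk)))

<-extensional : ∀ {m n} → (∀ t → t < m ⇔ t < n) → m ≡ n
<-extensional eq = ≤-antisym (≮⇒≥ (<-irrefl refl ∘ to (eq _))) (≮⇒≥ (<-irrefl refl ∘ from (eq _)))

-- The numbers below `g t` are exactly the j with `t < f j`, so f fixes g. As the relation is
-- symmetric, this one fact yields both well-definedness and injectivity of the final map.
conjugate-unique : ∀ {f f′ g g′} → Conjugate f g → Conjugate f′ g′ → f ≗ f′ → g ≗ g′
conjugate-unique c c′ f≗f′ t = <-extensional λ j → mk⇔
  (λ j<gt → to (c′ j t) (subst (t <_) (f≗f′ j) (from (c j t) j<gt)))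
  (λ j<g′t → to (c j t) (subst (t <_) (sym (f≗f′ j)) (from (c′ j t) j<g′t)))

-- The number of j < N with t < f j, for antitone f.
conjugate : ℕ → (ℕ → ℕ) → ℕ → ℕ
conjugate zero    f t = 0
conjugate (suc N) f t with t <? f 0
... | yes _ = suc (conjugate N (f ∘ suc) t)
... | no  _ = 0

-- Antitonicity makes the j with `t < f j` an initial segment, so counting may stop at the first
-- failure; as f vanishes from N on, N steps suffice.
conjugate-correct : ∀ N f → (∀ j → f (suc j) ≤ f j) → (∀ j → N ≤ j → f j ≡ 0) →
                    Conjugate f (conjugate N f)
conjugate-correct zero    f anti vanish j t rewrite vanish j z≤n = mk⇔ (λ ()) (λ ())
conjugate-correct (suc N) f anti vanish j t with t <? f 0
conjugate-correct (suc N) f anti vanish zero    t | yes t<f0 = mk⇔ (λ _ → z<s) (λ _ → t<f0)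
conjugate-correct (suc N) f anti vanish (suc j) t | yes _    =
  mk⇔ (s≤s ∘ to ih) (from ih ∘ s≤s⁻¹)
  where ih = conjugate-correct N (f ∘ suc) (anti ∘ suc) (λ j → vanish (suc j) ∘ s≤s) j t
conjugate-correct (suc N) f anti vanish j       t | no t≮f0  =
  mk⇔ (λ t<fj → contradiction (<-≤-trans t<fj (below j)) t≮f0) (λ ())
  where
  below : ∀ j → f j ≤ f 0
  below zero    = ≤-refl
  below (suc j) = ≤-trans (anti j) (below j)

-- The Triple Rule and the conditions on counts

record IsFilling {n} (γ : WeakComposition n) (f : Fin n → ℕ → ℕ) : Set where
  field
    support  : ∀ i j → 0 < f i j ⇔ j < Vec.lookup γ i
    antitone : ∀ i {j k} → j ≤ k → f i k ≤ f i j
    leading  : ∀ i → 0 < Vec.lookup γ i → f i 0 ≡ suc (toℕ i)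
    triple   : ∀ {a b} → a Fin.< b → ∀ j → 0 < f b (suc j) →
               f a (suc j) ≤ f b (suc j) → f a j < f b (suc j)

-- The conditions on a pattern, read along its diagonals: with 0-based i and t,
-- g i t is the entry x_{t+1,i−t+1}.
record IsCounting {n} (γ : WeakComposition n) (g : Fin n → ℕ → ℕ) : Set where
  field
    shape       : ∀ i → g i 0 ≡ Vec.lookup γ i
    vanishing   : ∀ i t → toℕ i < t → g i t ≡ 0
    antitone    : ∀ i t → g i (suc t) ≤ g i t
    condition-a : ∀ {a b} t → a Fin.< b → t ≤ toℕ a →
                  g b (suc t) ≤ g a (suc t) → g b t ≤ g a (suc t)
    condition-b : ∀ {a b} t → a Fin.< b → t ≤ toℕ a →
                  g a (suc t) < g b (suc t) → g b (suc t) < g b t → g a t < g b (suc t)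

module _ {n} {γ : WeakComposition n} {f g : Fin n → ℕ → ℕ} (c : ∀ i → Conjugate (f i) (g i)) where

  private
    c⁻¹ : ∀ i → Conjugate (g i) (f i)
    c⁻¹ i = conjugate-sym (c i)

  -- Row b holds t + 1 exactly in the columns j with `g b (suc t)` ≤ j < `g b t`. Both (a), by
  -- contradiction, and (b) come from the Triple Rule at one well-chosen column of this range.
  filling⇒counting : IsFilling γ f → IsCounting γ g
  filling⇒counting filling = record
    { shape       = λ i → <-extensional λ j → mk⇔
        (to (support i j) ∘ from (c i j 0)) (to (c i j 0) ∘ from (support i j))
    ; vanishing   = λ i t i<t →
        n≤0⇒n≡0 (≮⇒≥ λ 0<gt → <⇒≱ i<t (s≤s⁻¹ (diagonal-length i t 0<gt)))
    ; antitone    = λ i t → conjugate-antitone (c⁻¹ i) (n≤1+n t)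
    ; condition-a = λ t a<b t≤a gb≤ga → ≮⇒≥ λ ga<gb → a-violated t a<b t≤a gb≤ga ga<gb refl
    ; condition-b = λ t a<b _ ga<gb gb<gb′ → b-holds t a<b ga<gb gb<gb′ refl
    }
    where
    open IsFilling filling

    diagonal-length : ∀ i t → 0 < g i t → t < suc (toℕ i)
    diagonal-length i t 0<gt = subst (t <_) (leading i (to (support i 0) (m<n⇒0<n t<f0))) t<f0
      where t<f0 = from (c i 0 t) 0<gt

    -- The first two bounds say that row b holds t + 1 in column j + 1, the third that row a holds
    -- at most t + 1 there; the Triple Rule then leaves row a at most t in column j.
    triple′ : ∀ {a b} → a Fin.< b → ∀ j t → suc j < g b t →
              g b (suc t) ≤ suc j → g a (suc t) ≤ suc j → g a t ≤ j
    triple′ {a} {b} a<b j t j<gb gb≤j ga≤j = conjugate-≤ (c a) (s≤s⁻¹ fa<t)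
      where
      fb≡t : f b (suc j) ≡ suc t
      fb≡t = ≤-antisym (conjugate-≤ (c⁻¹ b) gb≤j) (from (c b (suc j) t) j<gb)
      fa<t : f a j < suc t
      fa<t = subst (f a j <_) fb≡t (triple a<b j (subst (0 <_) (sym fb≡t) z<s)
        (subst (f a (suc j) ≤_) (sym fb≡t) (conjugate-≤ (c⁻¹ a) ga≤j)))

    -- If (a) fails, row b holds t + 1 in column m = `g a (suc t)`. Column 0 is excluded, since the
    -- first entry b + 1 would be at most t + 1 although t ≤ a < b. In a later column j + 1,
    -- `triple′` gives `g a t` ≤ j, against `g a t` ≥ `g a (suc t)` = j + 1.
    a-violated : ∀ {a b m} t → a Fin.< b → t ≤ toℕ a →
                 g b (suc t) ≤ m → m < g b t → g a (suc t) ≢ m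
    a-violated {b = b} {zero} t a<b t≤a gb≤0 0<gb _ =
      <⇒≱ (≤-<-trans t≤a a<b) (s≤s⁻¹ (subst (_≤ suc t)
        (leading b (to (support b 0) (m<n⇒0<n (from (c b 0 t) 0<gb)))) (conjugate-≤ (c⁻¹ b) gb≤0)))
    a-violated {a} {b} {suc j} t a<b t≤a gb≤m m<gb ga≡m =
      <⇒≱ (<-≤-trans (subst (j <_) (sym ga≡m) ≤-refl) (conjugate-antitone (c⁻¹ a) (n≤1+n t)))
          (triple′ a<b j t m<gb gb≤m (≤-reflexive ga≡m))

    -- Column m = `g b (suc t)` is the first in which row b holds t + 1, and `g a (suc t)` < m keeps
    -- it away from column 0.
    b-holds : ∀ {a b m} t → a Fin.< b → g a (suc t) < m → m < g b t →
              g b (suc t) ≡ m → g a t < m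
    b-holds {m = suc j} t a<b ga<m m<gb gb≡m =
      s≤s (triple′ a<b j t m<gb (≤-reflexive gb≡m) (<⇒≤ ga<m))

  counting⇒filling : IsCounting γ g → IsFilling γ f
  counting⇒filling counting = record
    { support  = support′
    ; antitone = λ i → conjugate-antitone (c i)
    -- Diagonal i is positive at t = i and zero at t = i + 1, so the largest entry of row i is i +
    -- 1.
    ; leading  = λ i 0<γᵢ → ≤-antisym
        (conjugate-≤ (c⁻¹ i) (≤-reflexive (vanishing i (suc (toℕ i)) ≤-refl)))
        (from (c i 0 (toℕ i)) (nonempty i 0<γᵢ (toℕ i) ≤-refl))
    ; triple   = λ a<b j 0<fb fa≤fb → triple′ a<b j 0<fb fa≤fb refl
    }
    where
    open IsCounting counting

    support′ : ∀ i j → 0 < f i j ⇔ j < Vec.lookup γ i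
    support′ i j = subst (λ m → 0 < f i j ⇔ j < m) (shape i) (c i j 0)

    -- Condition (a) with r = 0, that is, for the diagonal a = t ending in row t.
    nonempty : ∀ i → 0 < Vec.lookup γ i → ∀ t → t ≤ toℕ i → 0 < g i t
    nonempty i 0<γᵢ zero    _   = subst (0 <_) (sym (shape i)) 0<γᵢ
    nonempty i 0<γᵢ (suc t) t<i = ≰⇒> λ gi≤0 → <⇒≱ (nonempty i 0<γᵢ t (<⇒≤ t<i))
      (≤-trans (condition-a t (subst (_< toℕ i) (sym a≡t) t<i) (≤-reflexive (sym a≡t))
        (≤-trans gi≤0 z≤n)) (≤-reflexive (vanishing a (suc t) (s≤s (≤-reflexive a≡t)))))
      where
      t<n : t < n
      t<n = <-trans t<i (Fin.toℕ<n i)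
      a : Fin n
      a = fromℕ< t<n
      a≡t : toℕ a ≡ t
      a≡t = Fin.toℕ-fromℕ< t<n

    -- With m = t + 1, the goal is `g a t` ≤ j. If a < t, diagonal a has already ended. If
    -- `g b (suc t)` ≤ `g a (suc t)`, then (a) bounds `g b t` by j + 1, although row b holds t + 1
    -- in that column. Otherwise (b) gives `g a t` < `g b (suc t)` ≤ j + 1.
    triple′ : ∀ {a b m} → a Fin.< b → ∀ j → 0 < m → f a (suc j) ≤ m →
              f b (suc j) ≡ m → f a j < m
    triple′ {a} {b} {suc t} a<b j _ fa≤t fb≡t = s≤s (conjugate-≤ (c⁻¹ a) ga≤j)
      where
      j<gb : suc j < g b t
      j<gb = to (c b (suc j) t) (≤-reflexive (sym fb≡t))
      gb≤j : g b (suc t) ≤ suc j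
      gb≤j = conjugate-≤ (c b) (≤-reflexive fb≡t)
      ga≤j : g a t ≤ j
      ga≤j with t ≤? toℕ a
      ... | no t≰a = ≤-trans (≤-reflexive (vanishing a t (≰⇒> t≰a))) z≤n
      ... | yes t≤a with g b (suc t) ≤? g a (suc t)
      ...   | yes gb≤ga = contradiction
                (≤-trans (condition-a t a<b t≤a gb≤ga) (conjugate-≤ (c a) fa≤t)) (<⇒≱ j<gb)
      ...   | no  gb≰ga = s≤s⁻¹ (≤-trans
                (condition-b t a<b t≤a (≰⇒> gb≰ga) (≤-<-trans gb≤j j<gb)) gb≤j)

filling⇒conjugate : ∀ {n} {γ : WeakComposition n} {f} → IsFilling γ f →
                    ∃[ g ] ∀ i → Conjugate (f i) (g i)
filling⇒conjugate {γ = γ} {f} filling = (λ i → conjugate (Vec.lookup γ i) (f i)) , λ i →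
  conjugate-correct _ (f i) (λ j → antitone i (n≤1+n j))
    (λ j γᵢ≤j → n≤0⇒n≡0 (≮⇒≥ (≤⇒≯ γᵢ≤j ∘ to (support i j))))
  where open IsFilling filling

counting⇒conjugate : ∀ {n} {γ : WeakComposition n} {g} → IsCounting γ g →
                     ∃[ f ] ∀ i → Conjugate (f i) (g i)
counting⇒conjugate {g = g} counting = (λ i → conjugate (suc (toℕ i)) (g i)) , λ i →
  conjugate-sym (conjugate-correct _ (g i) (antitone i) (vanishing i))
  where open IsCounting counting

-- Patterns and their diagonals

[]-inside : ∀ {n} (X : Position n → ℕ) {t u} (t<n : t < n) (u<n-t : u < n ∸ toℕ (fromℕ< t<n)) →
            X [ suc t , suc u ] ≡ X (fromℕ< t<n , fromℕ< u<n-t)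
[]-inside {n} X {t} {u} t<n u<n-t with t <? n
... | no  t≮n = contradiction t<n t≮n
... | yes _ with u <? n ∸ toℕ (fromℕ< t<n)
...   | no  u≮n-t = contradiction u<n-t u≮n-t
...   | yes _     = refl

[]-position : ∀ {n} (X : Position n → ℕ) i j → X [ suc (toℕ i) , suc (toℕ j) ] ≡ X (i , j)
[]-position {n} X i j = trans ([]-inside X i<n j<n-i) (rebuild (fromℕ< i<n) (Fin.fromℕ<-toℕ i i<n) j<n-i)
  where
  i<n : toℕ i < n
  i<n = Fin.toℕ<n i
  j<n-i : toℕ j < n ∸ toℕ (fromℕ< i<n)
  j<n-i = subst (λ k → toℕ j < n ∸ toℕ k) (sym (Fin.fromℕ<-toℕ i i<n)) (Fin.toℕ<n j)
  -- The row index becomes a variable, so that matching on `k ≡ i` also transports the column index,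
  -- whose type depends on it.
  rebuild : ∀ k → k ≡ i → (q : toℕ j < n ∸ toℕ k) → X (k , fromℕ< q) ≡ X (i , j)
  rebuild _ refl q = cong (λ l → X (i , l)) (Fin.fromℕ<-toℕ j q)

[]-cong : ∀ {n} {X Y : Position n → ℕ} → X ≗ Y → ∀ i j → X [ i , j ] ≡ Y [ i , j ]
[]-cong X≗Y zero    j       = refl
[]-cong X≗Y (suc i) zero    = refl
[]-cong {n} X≗Y (suc i) (suc j) with i <? n
... | no  _   = refl
... | yes i<n with j <? n ∸ toℕ (fromℕ< i<n)
...   | no  _ = refl
...   | yes _ = X≗Y _

-- Diagonal i ends, with t = suc (toℕ i), in column 0; from there on it is zero.
diagonals : ∀ {n} → (Position n → ℕ) → Fin n → ℕ → ℕ
diagonals X i t = X [ suc t , suc (toℕ i) ∸ t ]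

module _ {n} (X : Position n → ℕ) where

  diagonals-at : ∀ {i} t s → toℕ i ≡ t + s → diagonals X i t ≡ X [ suc t , suc s ]
  diagonals-at t s i≡t+s = cong (X [ suc t ,_])
    (trans (cong (λ k → suc k ∸ t) i≡t+s) (trans (cong (_∸ t) (sym (+-suc t s))) (m+n∸m≡n t (suc s))))

  diagonals-after : ∀ {i} t s → toℕ i ≡ t + s → diagonals X i (suc t) ≡ X [ suc (suc t) , s ]
  diagonals-after t s i≡t+s = cong (X [ suc (suc t) ,_])
    (trans (cong (_∸ t) i≡t+s) (m+n∸m≡n t s))

  -- The forms s + 1 and suc t + 1 are those of the pattern conditions.
  diagonals-at-+1 : ∀ {i} t s → toℕ i ≡ t + s → diagonals X i t ≡ X [ suc t , s + 1 ]
  diagonals-at-+1 t s i≡t+s = trans (diagonals-at t s i≡t+s) (cong (X [ suc t ,_]) (+-comm 1 s))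

  diagonals-after-+1 : ∀ {i} t s → toℕ i ≡ t + s → diagonals X i (suc t) ≡ X [ suc t + 1 , s ]
  diagonals-after-+1 t s i≡t+s = trans (diagonals-after t s i≡t+s) (cong (X [_, s ]) (+-comm 1 (suc t)))

  diagonals-vanishing : ∀ i t → toℕ i < t → diagonals X i t ≡ 0
  diagonals-vanishing i t i<t = cong (X [ suc t ,_]) (m≤n⇒m∸n≡0 i<t)

diagonal-bound : ∀ {n t s} → suc t ≤ n → s ≤ n ∸ suc t → t + s < n
diagonal-bound {n} {t} {s} t<n s≤ = subst (_≤ n) (+-comm s (suc t)) (m≤o∸n⇒m+n≤o s t<n s≤)

column-bound : ∀ {n t s} → t + s < n → s ≤ n ∸ suc t
column-bound {n} {t} {s} t+s<n = m+n≤o⇒m≤o∸n s (subst (_≤ n) (+-comm (suc t) s) t+s<n)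

diagonal : ∀ {n} t s → t + s < n → ∃[ i ] toℕ {n} i ≡ t + s
diagonal t s t+s<n = fromℕ< t+s<n , Fin.toℕ-fromℕ< t+s<n

diagonal-through : ∀ {n} ((i , j) : Position n) → ∃[ k ] toℕ {n} k ≡ toℕ i + toℕ j
diagonal-through {n} (i , j) = diagonal (toℕ i) (toℕ j) (subst (_< n) (+-comm (toℕ j) (toℕ i))
  (m≤o∸n⇒m+n≤o (suc (toℕ j)) (<⇒≤ (Fin.toℕ<n i)) (Fin.toℕ<n j)))

-- Every position of the triangle lies on some diagonal.
diagonals-injective : ∀ {n} (X Y : Position n → ℕ) →
                      (∀ i → diagonals X i ≗ diagonals Y i) → X ≗ Y
diagonals-injective {n} X Y eq p@(i , j) = begin
  X (i , j)                         ≡⟨ []-position X i j ⟨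
  X [ suc (toℕ i) , suc (toℕ j) ]   ≡⟨ diagonals-at X (toℕ i) (toℕ j) k≡i+j ⟨
  diagonals X k (toℕ i)             ≡⟨ eq k (toℕ i) ⟩
  diagonals Y k (toℕ i)             ≡⟨ diagonals-at Y (toℕ i) (toℕ j) k≡i+j ⟩
  Y [ suc (toℕ i) , suc (toℕ j) ]   ≡⟨ []-position Y i j ⟩
  Y (i , j)                         ∎
  where
  open ≡-Reasoning
  k = proj₁ (diagonal-through p)
  k≡i+j = proj₂ (diagonal-through p)

-- For t ≤ i, diagonal i runs through positions shared with no other diagonal, so its entries there
-- are free; after that the convention on column 0 makes it zero, in agreement with the hypothesis
-- on g.
diagonals-surjective : ∀ {n} (g : Fin n → ℕ → ℕ) → (∀ i t → toℕ i < t → g i t ≡ 0) →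
                       ∃[ X ] ∀ i → diagonals X i ≗ g i
diagonals-surjective {n} g vanish = X , diagonals≗g
  where
  X : Position n → ℕ
  X p@(i , j) = g (proj₁ (diagonal-through p)) (toℕ i)

  diagonals≗g : ∀ i → diagonals X i ≗ g i
  diagonals≗g i t with t ≤? toℕ i
  ... | no  t≰i = trans (diagonals-vanishing X i t (≰⇒> t≰i)) (sym (vanish i t (≰⇒> t≰i)))
  ... | yes t≤i = begin
    diagonals X i t                   ≡⟨ diagonals-at X t s (sym t+s≡i) ⟩
    X [ suc t , suc s ]               ≡⟨ []-inside X t<n s<n-t ⟩
    X p                               ≡⟨ cong₂ g (Fin.toℕ-injective k≡i) (Fin.toℕ-fromℕ< t<n) ⟩
    g i t                             ∎
    where
    open ≡-Reasoning
    s = toℕ i ∸ t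
    t+s≡i : t + s ≡ toℕ i
    t+s≡i = m+[n∸m]≡n t≤i
    t<n : t < n
    t<n = ≤-<-trans t≤i (Fin.toℕ<n i)
    s<n-t : s < n ∸ toℕ (fromℕ< t<n)
    s<n-t = subst (λ k → s < n ∸ k) (sym (Fin.toℕ-fromℕ< t<n)) (∸-monoˡ-< (Fin.toℕ<n i) t≤i)
    p : Position n
    p = fromℕ< t<n , fromℕ< s<n-t
    k≡i : toℕ (proj₁ (diagonal-through p)) ≡ toℕ i
    k≡i = trans (proj₂ (diagonal-through p))
      (trans (cong₂ _+_ (Fin.toℕ-fromℕ< t<n) (Fin.toℕ-fromℕ< s<n-t)) t+s≡i)

module _ {n} {γ : WeakComposition n} {X : Position n → ℕ} where

  -- With row t + 1 as the i of the conditions, r = a - t and s = b - t, the entries x_{i,r+1} and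
  -- x_{i+1,r} are consecutive on diagonal a, and those for s on diagonal b. The case r = 0 is t =
  -- a, where diagonal a ends.
  pattern⇒counting : IsPattern γ X → IsCounting γ (diagonals X)
  pattern⇒counting isPattern = record
    { shape       = λ i → sym (shape i)
    ; vanishing   = diagonals-vanishing X
    ; antitone    = antitone
    ; condition-a = condition-a′
    ; condition-b = condition-b′
    }
    where
    open IsPattern isPattern

    antitone : ∀ i t → diagonals X i (suc t) ≤ diagonals X i t
    antitone i t with t <? toℕ i
    -- The next entry lies in column 0, on which `decreasing` is silent, and is zero.
    ... | no  t≮i = ≤-trans (≤-reflexive (diagonals-vanishing X i (suc t) (s≤s (≮⇒≥ t≮i)))) z≤n
    ... | yes t<i = subst₂ _≤_ (sym (diagonals-after X t s i≡t+s))
        (sym (diagonals-at-+1 X t s i≡t+s))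
        (decreasing (suc (suc t)) s (s≤s (s≤s z≤n)) 2+t≤n (m<n⇒0<n∸m t<i) s≤)
      where
      s = toℕ i ∸ t
      i≡t+s : toℕ i ≡ t + s
      i≡t+s = sym (m+[n∸m]≡n (<⇒≤ t<i))
      2+t≤n : suc (suc t) ≤ n
      2+t≤n = <-≤-trans (s≤s t<i) (Fin.toℕ<n i)
      s≤ : s ≤ n ∸ suc (suc t) + 1
      s≤ = ≤-trans (column-bound (subst (_< n) i≡t+s (Fin.toℕ<n i)))
        (≤-reflexive (trans (+-∸-assoc 1 2+t≤n) (+-comm 1 _)))

    module _ {a b : Fin n} (t : ℕ) (a<b : a Fin.< b) (t≤a : t ≤ toℕ a) where
      private
        r = toℕ a ∸ t
        s = toℕ b ∸ t
        t≤b : t ≤ toℕ b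
        t≤b = <⇒≤ (≤-<-trans t≤a a<b)
        a≡t+r : toℕ a ≡ t + r
        a≡t+r = sym (m+[n∸m]≡n t≤a)
        b≡t+s : toℕ b ≡ t + s
        b≡t+s = sym (m+[n∸m]≡n t≤b)
        t<n : suc t ≤ n ∸ 1
        t<n = ≤-trans (≤-<-trans t≤a a<b) (Fin.toℕ≤pred[n] b)
        r<s : r < s
        r<s = ∸-monoˡ-< a<b t≤a
        s≤ : s ≤ n ∸ suc t
        s≤ = column-bound (subst (_< n) b≡t+s (Fin.toℕ<n b))

      condition-a′ : diagonals X b (suc t) ≤ diagonals X a (suc t) →
                     diagonals X b t ≤ diagonals X a (suc t)
      condition-a′ rewrite diagonals-after-+1 X t r a≡t+r | diagonals-after-+1 X t s b≡t+s
                         | diagonals-at-+1 X t s b≡t+s =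
        condition-a (suc t) r s z<s t<n r<s s≤

      condition-b′ : diagonals X a (suc t) < diagonals X b (suc t) →
                     diagonals X b (suc t) < diagonals X b t → diagonals X a t < diagonals X b (suc t)
      condition-b′ rewrite diagonals-after-+1 X t r a≡t+r | diagonals-after-+1 X t s b≡t+s
                         | diagonals-at-+1 X t r a≡t+r | diagonals-at-+1 X t s b≡t+s =
        condition-b (suc t) r s z<s t<n r<s s≤

  counting⇒pattern : IsCounting γ (diagonals X) → IsPattern γ X
  counting⇒pattern counting = record
    { shape       = λ i → sym (shape i)
    ; decreasing  = decreasing
    ; condition-a = λ where (suc t) r s _ t<n r<s s≤ → condition-a′ t r s t<n r<s s≤
    ; condition-b = λ where (suc t) r s _ t<n r<s s≤ → condition-b′ t r s t<n r<s s≤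
    }
    where
    open IsCounting counting

    decreasing : ∀ i j → 2 ≤ i → i ≤ n → 1 ≤ j → j ≤ n ∸ i + 1 → X [ i , j ] ≤ X [ i ∸ 1 , j + 1 ]
    decreasing (suc (suc t)) (suc u) _ 2+t≤n _ u<
      with v , v≡ ← diagonal {n} (suc t) u (diagonal-bound 2+t≤n (s≤s⁻¹ (subst (suc u ≤_) (+-comm _ 1) u<))) =
      subst₂ _≤_ (diagonals-at X (suc t) u v≡)
        (diagonals-at-+1 X t (suc u) (trans v≡ (sym (+-suc t u)))) (antitone v t)
    decreasing (suc zero) _ (s≤s ())

    module _ (t r s : ℕ) (t<n∸1 : suc t ≤ n ∸ 1) (r<s : r < s) (s≤ : s ≤ n ∸ suc t) where
      private
        t+s<n : t + s < n
        t+s<n = diagonal-bound (≤-trans t<n∸1 (m∸n≤m n 1)) s≤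
        t+r<n : t + r < n
        t+r<n = <-trans (+-monoʳ-< t r<s) t+s<n
        a b : Fin n
        a = proj₁ (diagonal t r t+r<n)
        b = proj₁ (diagonal t s t+s<n)
        a≡t+r : toℕ a ≡ t + r
        a≡t+r = proj₂ (diagonal t r t+r<n)
        b≡t+s : toℕ b ≡ t + s
        b≡t+s = proj₂ (diagonal t s t+s<n)
        a<b : a Fin.< b
        a<b = subst₂ _<_ (sym a≡t+r) (sym b≡t+s) (+-monoʳ-< t r<s)
        t≤a : t ≤ toℕ a
        t≤a = subst (t ≤_) (sym a≡t+r) (m≤m+n t r)

      condition-a′ : X [ suc t + 1 , s ] ≤ X [ suc t + 1 , r ] → X [ suc t , s + 1 ] ≤ X [ suc t + 1 , r ]
      condition-a′ rewrite sym (diagonals-after-+1 X t r a≡t+r) | sym (diagonals-after-+1 X t s b≡t+s)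
                         | sym (diagonals-at-+1 X t s b≡t+s) =
        condition-a t a<b t≤a

      condition-b′ : X [ suc t + 1 , r ] < X [ suc t + 1 , s ] →
                     X [ suc t + 1 , s ] < X [ suc t , s + 1 ] → X [ suc t , r + 1 ] < X [ suc t + 1 , s ]
      condition-b′ rewrite sym (diagonals-after-+1 X t r a≡t+r) | sym (diagonals-after-+1 X t s b≡t+s)
                         | sym (diagonals-at-+1 X t r a≡t+r) | sym (diagonals-at-+1 X t s b≡t+s) =
        condition-b t a<b t≤a

-- Tableaux and their rows

module _ (α : Composition) where
  open Composition α

  module _ (U : Cell α → ℕ) where

    padded-inside : ∀ k {j} (j<αₖ : j < part k) → padded α U k j ≡ U (k , fromℕ< j<αₖ)
    padded-inside k {j} j<αₖ with j <? part k
    ... | yes _    = refl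
    ... | no  j≮αₖ = contradiction j<αₖ j≮αₖ

    padded-outside : ∀ k {j} → part k ≤ j → padded α U k j ≡ 0
    padded-outside k {j} αₖ≤j with j <? part k
    ... | yes j<αₖ = contradiction αₖ≤j (<⇒≱ j<αₖ)
    ... | no  _    = refl

    padded-cell : ∀ k c → padded α U k (toℕ c) ≡ U (k , c)
    padded-cell k c = trans (padded-inside k (Fin.toℕ<n c))
      (cong (λ d → U (k , d)) (Fin.fromℕ<-toℕ c (Fin.toℕ<n c)))

  module _ {U : Cell α → ℕ} (columnStrict : IsColumnStrict α U) where
    open IsColumnStrict columnStrict

    padded-support : ∀ k j → 0 < padded α U k j ⇔ j < part k
    padded-support k j = mk⇔
      (λ 0<U → ≰⇒> λ αₖ≤j → n≮0 (subst (0 <_) (padded-outside U k αₖ≤j) 0<U))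
      (λ j<αₖ → subst (0 <_) (sym (padded-inside U k j<αₖ)) (positive-entries _))

    padded-antitone : ∀ k {i j} → i ≤ j → padded α U k j ≤ padded α U k i
    padded-antitone k {i} {j} i≤j with j <? part k
    ... | no  _    = z≤n
    ... | yes j<αₖ = subst (U _ ≤_) (sym (padded-inside U k i<αₖ)) (rows-decreasing k
      (subst₂ _≤_ (sym (Fin.toℕ-fromℕ< i<αₖ)) (sym (Fin.toℕ-fromℕ< j<αₖ)) i≤j))
      where i<αₖ = ≤-<-trans i≤j j<αₖ

    padded-triple : ∀ {k l} → k Fin.< l → ∀ j → 0 < padded α U l (suc j) →
                    padded α U k (suc j) ≤ padded α U l (suc j) →
                    padded α U k j < padded α U l (suc j)
    padded-triple {l = l} k<l j 0<U = triple-rule j k<l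
      -- A nonzero entry lies within row l, which is no longer than the largest part.
      (<-≤-trans (to (padded-support l (suc j)) 0<U) (All.lookup (xs≤max 0 parts) (∈-lookup l)))
      (>⇒≢ 0<U)

-- Strictly increasing sequences and their sets of values

StrictlyIncreasing : ∀ {m} → (Fin m → ℕ) → Set
StrictlyIncreasing f = ∀ {k l} → k Fin.< l → f k < f l

increasing⇒monotone : ∀ {m} (f : Fin m → ℕ) → StrictlyIncreasing f →
                      ∀ {k l} → k Fin.≤ l → f k ≤ f l
increasing⇒monotone f f-inc k≤l with m≤n⇒m<n∨m≡n k≤l
... | inj₁ k<l = <⇒≤ (f-inc k<l)
... | inj₂ k≡l = ≤-reflexive (cong f (Fin.toℕ-injective k≡l))

-- The values rise by at least one at each index; the offset c lets the induction pass to the tail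
-- with c + 1.
index≤value : ∀ {m} (f : Fin m → ℕ) → StrictlyIncreasing f → ∀ c → (∀ k → c ≤ f k) →
              ∀ k → c + toℕ k ≤ f k
index≤value f inc c c≤f zero    = subst (_≤ f zero) (sym (+-identityʳ c)) (c≤f zero)
index≤value f inc c c≤f (suc k) = subst (_≤ f (suc k)) (sym (+-suc c (toℕ k)))
  (index≤value (f ∘ suc) (inc ∘ s≤s) (suc c) (λ l → ≤-<-trans (c≤f zero) (inc z<s)) k)

-- The index map `φ` that locates each value of f among those of h is itself strictly increasing, so
-- `φ k` ≥ k and `h k` ≤ `h (φ k)` = `f k`. Used in both directions, this identifies two sequences
-- with the same set of values.
increasing-⊆⇒≤ : ∀ {m} (f h : Fin m → ℕ) → StrictlyIncreasing f → StrictlyIncreasing h →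
                 (∀ k → ∃[ l ] f k ≡ h l) → ∀ k → h k ≤ f k
increasing-⊆⇒≤ f h f-inc h-inc f⊆h k = subst (h k ≤_) (sym (f≡h k))
  (h-mono (index≤value (toℕ ∘ φ) φ-inc 0 (λ _ → z≤n) k))
  where
  φ : _
  φ = proj₁ ∘ f⊆h
  f≡h : ∀ k → f k ≡ h (φ k)
  f≡h = proj₂ ∘ f⊆h
  h-mono : ∀ {k l} → k Fin.≤ l → h k ≤ h l
  h-mono = increasing⇒monotone h h-inc
  φ-inc : StrictlyIncreasing (toℕ ∘ φ)
  φ-inc k<l = ≰⇒> λ φl≤φk → <⇒≱ (f-inc k<l) (subst₂ _≤_ (sym (f≡h _)) (sym (f≡h _)) (h-mono φl≤φk))

-- Rows labelled by the positions of the positive parts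

Row : ∀ {n} → WeakComposition n → Set
Row γ = Fin (Composition.rows (γ ⁺))

-- The position in γ of its k-th positive part. The clauses follow the computation of `filter` in
-- `_⁺`, so that `Row γ` reduces in each of them.
label : ∀ {n} (γ : WeakComposition n) → Row γ → Fin n
label (zero  ∷ γ) k       = suc (label γ k)
label (suc _ ∷ γ) zero    = zero
label (suc _ ∷ γ) (suc k) = suc (label γ k)

label-part : ∀ {n} (γ : WeakComposition n) k → Vec.lookup γ (label γ k) ≡ Composition.part (γ ⁺) k
label-part (zero  ∷ γ) k       = label-part γ k
label-part (suc _ ∷ γ) zero    = refl
label-part (suc _ ∷ γ) (suc k) = label-part γ k

label-increasing : ∀ {n} (γ : WeakComposition n) → StrictlyIncreasing (toℕ ∘ label γ)
label-increasing (zero  ∷ γ) k<l                       = s≤s (label-increasing γ k<l)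
label-increasing (suc _ ∷ γ) {zero}  {suc _} _         = z<s
label-increasing (suc _ ∷ γ) {suc _} {suc _} (s≤s k<l) = s≤s (label-increasing γ k<l)

locate : ∀ {n} (γ : WeakComposition n) i → (∃[ k ] label γ k ≡ i) ⊎ Vec.lookup γ i ≡ 0
locate (zero  ∷ γ) zero    = inj₂ refl
locate (suc _ ∷ γ) zero    = inj₁ (zero , refl)
locate (zero  ∷ γ) (suc i) = Sum.map₁ (map₂ (cong suc)) (locate γ i)
locate (suc _ ∷ γ) (suc i) = Sum.map₁ (λ (k , eq) → suc k , cong suc eq) (locate γ i)

module _ {n} (γ : WeakComposition n) where
  open Composition (γ ⁺) using (part; part-positive)

  label-positive : ∀ k → 0 < Vec.lookup γ (label γ k)
  label-positive k = subst (0 <_) (sym (label-part γ k)) (part-positive k)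

  label-reflects-< : ∀ {k l} → label γ k Fin.< label γ l → k Fin.< l
  label-reflects-< lk<ll =
    ≰⇒> λ l≤k → <⇒≱ lk<ll (increasing⇒monotone _ (label-increasing γ) l≤k)

  label-injective : ∀ {k l} → label γ k ≡ label γ l → k ≡ l
  label-injective eq = Fin.toℕ-injective (≤-antisym (≮⇒≥ (≮-by eq)) (≮⇒≥ (≮-by (sym eq))))
    where
    ≮-by : ∀ {k l} → label γ k ≡ label γ l → toℕ l ≮ toℕ k
    ≮-by eq l<k = <-irrefl (cong toℕ (sym eq)) (label-increasing γ l<k)

  spread : (Row γ → ℕ → ℕ) → Fin n → ℕ → ℕ
  spread h i j = [ (λ (k , _) → h k j) , (λ _ → 0) ]′ (locate γ i)

  spread-label : ∀ h k j → spread h (label γ k) j ≡ h k j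
  spread-label h k j with locate γ (label γ k)
  ... | inj₁ (l , eq) = cong (λ l → h l j) (label-injective eq)
  ... | inj₂ γ≡0      = contradiction γ≡0 (>⇒≢ (label-positive k))

  filling : (Cell (γ ⁺) → ℕ) → Fin n → ℕ → ℕ
  filling U = spread (padded (γ ⁺) U)

  filling-cell : ∀ U k c → filling U (label γ k) (toℕ c) ≡ U (k , c)
  filling-cell U k c = trans (spread-label (padded (γ ⁺) U) k (toℕ c)) (padded-cell (γ ⁺) U k c)

  filling-injective : ∀ U V → (∀ i → filling U i ≗ filling V i) → U ≗ V
  filling-injective U V eq (k , c) =
    trans (sym (filling-cell U k c)) (trans (eq (label γ k) (toℕ c)) (filling-cell V k c))

  filling-cong : ∀ {U V} → U ≗ V → ∀ i → filling U i ≗ filling V i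
  filling-cong U≗V i j with locate γ i
  ... | inj₂ _ = refl
  ... | inj₁ (k , _) with j <? part k
  ...   | yes _ = U≗V _
  ...   | no  _ = refl

  -- The first column and the 1-based labels both increase strictly and both have `𝓕 γ` as their set
  -- of values.
  first-entry : ∀ (T : CT (γ ⁺) (𝓕 γ)) k → CT.entry T (first (γ ⁺) k) ≡ suc (toℕ (label γ k))
  first-entry T k = ≤-antisym
    (increasing-⊆⇒≤ labels entries (s≤s ∘ label-increasing γ) first-increasing labels⊆entries k)
    (increasing-⊆⇒≤ entries labels first-increasing (s≤s ∘ label-increasing γ) entries⊆labels k)
    where
    open CT T
    open IsColumnStrict isColumnStrict
    labels entries : Row γ → ℕ
    labels  = suc ∘ toℕ ∘ label γ
    entries = entry ∘ first (γ ⁺)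
    labels⊆entries : ∀ k → ∃[ l ] labels k ≡ entries l
    labels⊆entries k = map₂ sym (proj₂ firstColumn≐ (label γ k , refl , label-positive k))
    entries⊆labels : ∀ k → ∃[ l ] entries k ≡ labels l
    entries⊆labels k with i , eq , 0<γᵢ ← proj₁ firstColumn≐ (k , refl) with locate γ i
    ... | inj₁ (l , refl) = l , eq
    ... | inj₂ γᵢ≡0       = contradiction γᵢ≡0 (>⇒≢ 0<γᵢ)

  tableau⇒filling : ∀ (T : CT (γ ⁺) (𝓕 γ)) → IsFilling γ (filling (CT.entry T))
  tableau⇒filling T = record
    { support = support ; antitone = antitone ; leading = leading ; triple = triple }
    where
    open CT T
    f = filling entry

    support : ∀ i j → 0 < f i j ⇔ j < Vec.lookup γ i
    support i j with locate γ i
    ... | inj₁ (k , refl) rewrite label-part γ k = padded-support (γ ⁺) isColumnStrict k j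
    ... | inj₂ γᵢ≡0       rewrite γᵢ≡0           = mk⇔ (λ ()) (λ ())

    antitone : ∀ i {j k} → j ≤ k → f i k ≤ f i j
    antitone i with locate γ i
    ... | inj₁ (k , _) = padded-antitone (γ ⁺) isColumnStrict k
    ... | inj₂ _       = λ _ → z≤n

    leading : ∀ i → 0 < Vec.lookup γ i → f i 0 ≡ suc (toℕ i)
    leading i 0<γᵢ with locate γ i
    ... | inj₁ (k , refl) = trans (padded-inside (γ ⁺) entry k (part-positive k)) (first-entry T k)
    ... | inj₂ γᵢ≡0       = contradiction γᵢ≡0 (>⇒≢ 0<γᵢ)

    triple : ∀ {a b} → a Fin.< b → ∀ j → 0 < f b (suc j) →
             f a (suc j) ≤ f b (suc j) → f a j < f b (suc j)
    triple {a} {b} a<b j 0<fb fa≤fb with locate γ a | locate γ b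
    ... | inj₁ (k , refl) | inj₁ (l , refl) =
      padded-triple (γ ⁺) isColumnStrict (label-reflects-< a<b) j 0<fb fa≤fb
    -- Row a is all zero, so the Triple Rule only asks that the entry of row b be positive.
    ... | inj₂ _          | inj₁ _          = 0<fb
    ... | _               | inj₂ _          = contradiction 0<fb n≮0

  -- Keeping only the labelled rows loses nothing, since `support` forces every other row to be
  -- zero.
  filling⇒tableau : ∀ {f} → IsFilling γ f →
                    Σ[ T ∈ CT (γ ⁺) (𝓕 γ) ] ∀ i → filling (CT.entry T) i ≗ f i
  filling⇒tableau {f} isFilling = T , filling≗f
    where
    open IsFilling isFilling

    U : Cell (γ ⁺) → ℕ
    U (k , c) = f (label γ k) (toℕ c)

    support′ : ∀ k j → 0 < f (label γ k) j ⇔ j < part k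
    support′ k j = subst (λ m → 0 < f (label γ k) j ⇔ j < m) (label-part γ k) (support (label γ k) j)

    padded≗f : ∀ k j → padded (γ ⁺) U k j ≡ f (label γ k) j
    padded≗f k j with j <? part k
    ... | yes j<αₖ = cong (f (label γ k)) (Fin.toℕ-fromℕ< j<αₖ)
    ... | no  j≮αₖ = sym (n≤0⇒n≡0 (≮⇒≥ (j≮αₖ ∘ to (support′ k j))))

    U-first : ∀ k → U (first (γ ⁺) k) ≡ suc (toℕ (label γ k))
    U-first k = trans (cong (f (label γ k)) (Fin.toℕ-fromℕ< (part-positive k)))
      (leading (label γ k) (label-positive k))

    triple-rule : TripleRule (γ ⁺) U
    triple-rule {k} {l} j k<l _ U≢0 U≤U rewrite padded≗f k j | padded≗f k (suc j) | padded≗f l (suc j) =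
      triple (label-increasing γ k<l) j (n≢0⇒n>0 U≢0) U≤U

    T : CT (γ ⁺) (𝓕 γ)
    T = record
      { entry          = U
      ; isColumnStrict = record
        { positive-entries = λ (k , c) → from (support′ k (toℕ c)) (Fin.toℕ<n c)
        ; first-increasing = λ k<l →
            subst₂ _<_ (sym (U-first _)) (sym (U-first _)) (s≤s (label-increasing γ k<l))
        ; rows-decreasing  = λ k → antitone (label γ k)
        ; triple-rule      = triple-rule
        }
      ; firstColumn≐   =
          (λ { (k , refl) → label γ k , U-first k , label-positive k }) , 𝓕⊆
      }
      where
      𝓕⊆ : ∀ {v} → 𝓕 γ v → firstColumn (γ ⁺) U v
      𝓕⊆ (i , refl , 0<γᵢ) with locate γ i
      ... | inj₁ (k , refl) = k , U-first k
      ... | inj₂ γᵢ≡0       = contradiction γᵢ≡0 (>⇒≢ 0<γᵢ)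

    filling≗f : ∀ i → filling U i ≗ f i
    filling≗f i j with locate γ i
    ... | inj₁ (k , refl) = padded≗f k j
    ... | inj₂ γᵢ≡0       =
      sym (n≤0⇒n≡0 (≮⇒≥ λ 0<f → n≮0 (subst (j <_) γᵢ≡0 (to (support i j) 0<f))))

-- The bijection

module _ {n} (γ : WeakComposition n) where

  -- A relation treats both sides alike: a partner exists for each tableau and for each pattern, and
  -- uniqueness of conjugates makes partners unique up to equality of entries. No composite of the
  -- two constructions has to be computed.
  Corresponds : CT (γ ⁺) (𝓕 γ) → CAP γ → Set
  Corresponds T Y = ∀ i → Conjugate (filling γ (CT.entry T) i) (diagonals (CAP.entry Y) i)

  tableau⇒pattern : ∀ T → ∃[ Y ] Corresponds T Y
  tableau⇒pattern T
    with g , c ← filling⇒conjugate (tableau⇒filling γ T)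
    with X , X≗g ← diagonals-surjective g
                     (IsCounting.vanishing (filling⇒counting c (tableau⇒filling γ T))) =
    record { entry = X ; isPattern = counting⇒pattern (filling⇒counting c′ (tableau⇒filling γ T)) } , c′
    where
    c′ : ∀ i → Conjugate (filling γ (CT.entry T) i) (diagonals X i)
    c′ i j t = subst (λ m → t < filling γ (CT.entry T) i j ⇔ j < m) (sym (X≗g i t)) (c i j t)

  pattern⇒tableau : ∀ Y → ∃[ T ] Corresponds T Y
  pattern⇒tableau Y
    with f , c ← counting⇒conjugate (pattern⇒counting (CAP.isPattern Y))
    with T , T≗f ← filling⇒tableau γ (counting⇒filling c (pattern⇒counting (CAP.isPattern Y))) =
    T , λ i j t → subst (λ m → t < m ⇔ j < diagonals (CAP.entry Y) i t) (sym (T≗f i j)) (c i j t)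

  corresponds-to : ∀ T T′ Y Y′ → Corresponds T Y → Corresponds T′ Y′ →
                   CT.entry T ≗ CT.entry T′ → CAP.entry Y ≗ CAP.entry Y′
  corresponds-to _ _ _ _ c c′ T≗T′ = diagonals-injective _ _
    λ i → conjugate-unique (c i) (c′ i) (filling-cong γ T≗T′ i)

  corresponds-from : ∀ T T′ Y Y′ → Corresponds T Y → Corresponds T′ Y′ →
                     CAP.entry Y ≗ CAP.entry Y′ → CT.entry T ≗ CT.entry T′
  corresponds-from _ _ _ _ c c′ Y≗Y′ = filling-injective γ _ _
    λ i → conjugate-unique (conjugate-sym (c i)) (conjugate-sym (c′ i))
      (λ t → []-cong Y≗Y′ (suc t) (suc (toℕ i) ∸ t))

theorem3p3p2 : ∀ (n : ℕ) (γ : WeakComposition n) →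
    Bijection (CT-setoid (γ ⁺) (𝓕 γ)) (CAP-setoid γ)
theorem3p3p2 n γ = record
  { to        = capOf
  ; cong      = λ {T} {T′} → corresponds-to γ T T′ (capOf T) (capOf T′) (corr T) (corr T′)
  ; bijective =
      (λ {T} {T′} → corresponds-from γ T T′ (capOf T) (capOf T′) (corr T) (corr T′))
    -- The partner of Y is a preimage: a tableau equal to it is sent to a pattern that must equal Y.
    , λ Y → let (T′ , c) = pattern⇒tableau γ Y in
        T′ , λ {T} → corresponds-to γ T T′ (capOf T) Y (corr T) c
  }
  where
  capOf : CT (γ ⁺) (𝓕 γ) → CAP γ
  capOf T = proj₁ (tableau⇒pattern γ T)
  corr : ∀ T → Corresponds γ T (capOf T)
  corr T = proj₂ (tableau⇒pattern γ T)
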